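{- Let $E$ be a monoidal equational theory. If $E$ is regular and restrictive, then $E$ is Noetherian w.r.t. the unrestricted instantiation preorder, i.e., every strictly descending chain of substitutions $\sigma_1>_E^V\sigma_2>_E^V\sigma_3>_E^V\cdots$ is finite.
   Context: $V$ is a countably infinite set of variables, $\Sigma$ a finite signature, $T(\Sigma,V)$ the set of terms, $\mathrm{Var}(t)$ the set of variables of $t$. An equational theory $E$ is a set of (implicitly universally quantified) identities between terms, and $\approx_E$ is the congruence relation it induces. All equational theories are assumed non-trivial: $x\approx_E y$ does not hold for distinct variables $x,y$. $E$ is regular if $\mathrm{Var}(s)=\mathrm{Var}(t)$ for all identities $s\approx t$ in $E$. Terms are built using only the function symbols occurring in $E$ (elementary setting), i.e., $\Sigma=\mathrm{Sig}(E)$. $E$ is monoidal if (i) its signature contains a constant $0$ and a binary symbol $f$, and all other function symbols are unary; (ii) $f$ is associative and commutative with unit $0$ modulo $\approx_E$: $f(x,y)\approx_E f(y,x)$, $f(x,f(y,z))\approx_E f(f(x,y),z)$, $f(x,0)\approx_E x$; (iii) every unary symbol $h$ satisfies $h(f(x,y))\approx_E f(h(x),h(y))$ and $h(0)\approx_E 0$. The semiring $\mathcal{S}_E=(S_E,\oplus,\mathsf{0},\otimes,\mathsf{1})$ associated with a monoidal theory $E$: fix a variable $x$; $S_E$ is the set of $\approx_E$-classes of terms containing no variable other than $x$, with $[s]\oplus[t]=[f(s,t)]$, $\mathsf{0}=[0]$, $[s]\otimes[t]=[s\{x\mapsto t\}]$ (replace $x$ by $t$ in $s$), and $\mathsf{1}=[x]$.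 (Thus the class of any term $t$ with variables among $x_1,\dots,x_n$ is represented by a vector $(a_1,\dots,a_n)$ over $S_E$, and applying a substitution corresponds to multiplying this vector on the right by the matrix of the substitution.) A monoidal theory $E$ is restrictive if there is a total preorder $\leq$ on $S_E$ (reflexive, transitive, any two elements comparable), with strict part $<$ ($a<b$ iff $a\leq b$ and not $b\leq a$), such that: (1) for all $a,b,c\in S_E$ with $c\neq\mathsf{0}$: $a<b$ implies $a<b\otimes c$; (2) for all $a,b,c\in S_E$: $a<b$ implies $a<b\oplus c$; (3) for all $a\in S_E$ the set $\{b\in S_E\mid b\leq a\}$ is finite. A substitution is a map $\sigma:V\to T(\Sigma,V)$ with finite domain $\{x\in V\mid\sigma(x)\neq x\}$, extended homomorphically to terms. $\sigma\leq_E^V\tau$ iff there is a substitution $\lambda$ with $\lambda(\sigma(x))\approx_E\tau(x)$ for all $x\in V$; $\sigma<_E^V\tau$ (equivalently $\tau>_E^V\sigma$) iff $\sigma\leq_E^V\tau$ and not $\tau\leq_E^V\sigma$. -}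

module Defs where

open import Data.Fin using (Fin)
open import Data.List using (List)
open import Data.List.Membership.Propositional using () renaming (_∈_ to _∈ˡ_)
open import Data.List.Relation.Unary.Any using () renaming (Any to Anyˡ)
open import Data.Nat using (ℕ)
import Data.Nat.Properties as ℕ
open import Data.Product using (Σ; ∃; ∃-syntax; _×_; _,_)
open import Data.Sum using (_⊎_)
open import Data.Vec using (Vec; []; _∷_)
open import Data.Vec.Relation.Binary.Pointwise.Inductive using (Pointwise)
open import Data.Vec.Relation.Unary.Any using (Any; here; there)
open import Algebra.Bundles using (RawSemiring)
open import Function.Bundles using (_↔_)
open import Function.Properties.Inverse using (↔⇒↣)
open import Induction.InfiniteDescent using (InfiniteDescendingSequence)
open import Level using (Level; _⊔_; 0ℓ) renaming (suc to lsuc)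
open import Relation.Binary.Core using (Rel)
open import Relation.Binary.Definitions using (DecidableEquality)
open import Relation.Binary.PropositionalEquality using (_≡_; _≢_; refl)
open import Relation.Binary.Structures using (IsTotalPreorder)
open import Relation.Nullary using (¬_; yes; no; contradiction)
open import Relation.Nullary.Decidable using (via-injection)
open import Relation.Unary using (Pred; _≐_; _⊆_; ｛_｝)

record Signature : Set₁ where
  field
    Op : ℕ → Set   -- symbols, indexed by their arity

  Symbol : Set
  Symbol = Σ ℕ Op

  field
    size   : ℕ
    finite : Symbol ↔ Fin size

module _ (𝕊 : Signature) where
  open Signature 𝕊

  data Term (V : Set) : Set where
    var : V → Term V
    app : ∀ {n} → Op n → Vec (Term V) n → Term V

module _ {𝕊 : Signature} {V : Set} where
  open Signature 𝕊

  infix 4 _∈Var_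

  data _∈Var_ (x : V) : Term 𝕊 V → Set where
    here : x ∈Var var x
    arg  : ∀ {n} {g : Op n} {ts} → Any (x ∈Var_) ts → x ∈Var app g ts

  Var : Term 𝕊 V → Pred V 0ℓ
  Var t x = x ∈Var t

  data OccursIn {n} (g : Op n) : Term 𝕊 V → Set where
    head : ∀ {ts} → OccursIn g (app g ts)
    arg  : ∀ {m} {h : Op m} {ts} → Any (OccursIn g) ts → OccursIn g (app h ts)

  infixl 8 _[_] _[_]*

  -- Homomorphic extension of an arbitrary assignment of terms to variables.
  _[_]  : Term 𝕊 V → (V → Term 𝕊 V) → Term 𝕊 V
  _[_]* : ∀ {n} → Vec (Term 𝕊 V) n → (V → Term 𝕊 V) → Vec (Term 𝕊 V) n
  var x    [ σ ]  = σ x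
  app g ts [ σ ]  = app g (ts [ σ ]*)
  []       [ σ ]* = []
  (t ∷ ts) [ σ ]* = t [ σ ] ∷ ts [ σ ]*

  ∈Var-[]  : ∀ (t : Term 𝕊 V) σ {y} → y ∈Var t [ σ ] → ∃[ z ] z ∈Var t × y ∈Var σ z
  ∈Var-[]* : ∀ {n} (ts : Vec (Term 𝕊 V) n) σ {y} → Any (y ∈Var_) (ts [ σ ]*) →
             ∃[ z ] Any (z ∈Var_) ts × y ∈Var σ z
  ∈Var-[] (var x) σ p = x , here , p
  ∈Var-[] (app g ts) σ (arg p) with ∈Var-[]* ts σ p
  ... | z , q , r = z , arg q , r
  ∈Var-[]* (t ∷ ts) σ (here p) with ∈Var-[] t σ p
  ... | z , q , r = z , here q , r
  ∈Var-[]* (t ∷ ts) σ (there p) with ∈Var-[]* ts σ p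
  ... | z , q , r = z , there q , r

record Substitution (𝕊 : Signature) (V : Set) : Set where
  field
    fun          : V → Term 𝕊 V
    finiteDomain : ∃[ xs ] (∀ x → fun x ≢ var x → x ∈ˡ xs)

open Substitution public using (fun)

module _ {𝕊 : Signature} {V : Set} {ℓ : Level} where
  open Signature 𝕊

  -- The least congruence containing every instance of the identities.
  data Induced (_≐ᴱ_ : Rel (Term 𝕊 V) ℓ) : Rel (Term 𝕊 V) ℓ where
    axiom   : ∀ {s t} → s ≐ᴱ t → ∀ σ → Induced _≐ᴱ_ (s [ σ ]) (t [ σ ])
    ≈-refl  : ∀ {t} → Induced _≐ᴱ_ t t
    ≈-sym   : ∀ {s t} → Induced _≐ᴱ_ s t → Induced _≐ᴱ_ t s
    ≈-trans : ∀ {s t u} → Induced _≐ᴱ_ s t → Induced _≐ᴱ_ t u → Induced _≐ᴱ_ s u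
    ≈-cong  : ∀ {n} (g : Op n) {ss ts} → Pointwise (Induced _≐ᴱ_) ss ts →
              Induced _≐ᴱ_ (app g ss) (app g ts)

record EquationalTheory (V : Set) (ℓ : Level) : Set (lsuc ℓ) where
  infix 4 _≈ᴱ_
  field
    countable : V ↔ ℕ
    𝕊         : Signature
    Identity  : Rel (Term 𝕊 V) ℓ

  _≈ᴱ_ : Rel (Term 𝕊 V) ℓ
  _≈ᴱ_ = Induced Identity

  open Signature 𝕊 public using (Op; Symbol)

  field
    nontrivial : ∀ {x y : V} → x ≢ y → ¬ (var x ≈ᴱ var y)
    elementary : ∀ {n} (g : Op n) →
                 ∃[ s ] ∃[ t ] Identity s t × (OccursIn g s ⊎ OccursIn g t)

  _≟ⱽ_ : DecidableEquality V
  _≟ⱽ_ = via-injection (↔⇒↣ countable) ℕ._≟_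

module _ {V : Set} {ℓ : Level} (E : EquationalTheory V ℓ) where
  open EquationalTheory E

  Regular : Set ℓ
  Regular = ∀ {s t} → Identity s t → Var s ≐ Var t

  record Monoidal : Set ℓ where
    field
      zeroᴱ  : Op 0
      plusᴱ  : Op 2
      others : ∀ {n} (g : Op n) →
               _≡_ {A = Symbol} (n , g) (0 , zeroᴱ) ⊎
               _≡_ {A = Symbol} (n , g) (2 , plusᴱ) ⊎
               n ≡ 1

    𝟘 : Term 𝕊 V
    𝟘 = app zeroᴱ []

    f : Term 𝕊 V → Term 𝕊 V → Term 𝕊 V
    f s t = app plusᴱ (s ∷ t ∷ [])

    field
      f-comm  : ∀ (x y : V) → f (var x) (var y) ≈ᴱ f (var y) (var x)
      f-assoc : ∀ (x y z : V) →
                f (var x) (f (var y) (var z)) ≈ᴱ f (f (var x) (var y)) (var z)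
      f-unit  : ∀ (x : V) → f (var x) 𝟘 ≈ᴱ var x
      hom-f   : ∀ (h : Op 1) (x y : V) →
                app h (f (var x) (var y) ∷ []) ≈ᴱ f (app h (var x ∷ [])) (app h (var y ∷ []))
      hom-𝟘   : ∀ (h : Op 1) → app h (𝟘 ∷ []) ≈ᴱ 𝟘

  _↦_ : V → Term 𝕊 V → V → Term 𝕊 V
  (x ↦ t) y with y ≟ⱽ x
  ... | yes _ = t
  ... | no  _ = var y

  -- Classes are rendered by their representatives, compared by _≈ᴱ_.
  module _ (M : Monoidal) (x : V) where
    open Monoidal M

    OneVarTerm : Set
    OneVarTerm = Σ (Term 𝕊 V) λ t → Var t ⊆ ｛ x ｝

    𝒮 : RawSemiring 0ℓ ℓ
    𝒮 = record
      { Carrier = OneVarTerm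
      ; _≈_     = λ (s , _) (t , _) → s ≈ᴱ t
      ; _+_     = λ (s , p) (t , q) → f s t ,
                    λ { (arg (here r)) → p r ; (arg (there (here r))) → q r }
      ; _*_     = λ (s , p) (t , q) → s [ x ↦ t ] , closed s t p q
      ; 0#      = 𝟘 , λ { (arg ()) }
      ; 1#      = var x , λ { here → refl }
      }
      where
      closed : ∀ s t → Var s ⊆ ｛ x ｝ → Var t ⊆ ｛ x ｝ → Var (s [ x ↦ t ]) ⊆ ｛ x ｝
      closed s t p q r with ∈Var-[] s (x ↦ t) r
      ... | z , z∈s , y∈ with p z∈s
      ...   | refl with x ≟ⱽ x
      ...     | yes _  = q y∈
      ...     | no x≢x = contradiction refl x≢x

  infix 4 _≤ᴱ_ _<ᴱ_

  _≤ᴱ_ : Rel (Substitution 𝕊 V) ℓ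
  σ ≤ᴱ τ = ∃[ ρ ] (∀ x → fun σ x [ fun ρ ] ≈ᴱ fun τ x)

  _<ᴱ_ : Rel (Substitution 𝕊 V) ℓ
  σ <ᴱ τ = σ ≤ᴱ τ × ¬ (τ ≤ᴱ σ)

  -- A strictly descending chain is infinite precisely when it is indexed by all of ℕ.
  Noetherian : Set ℓ
  Noetherian = ¬ (∃[ σ ] InfiniteDescendingSequence _<ᴱ_ σ)

Strict : ∀ {a ℓ} {A : Set a} → Rel A ℓ → Rel A ℓ
Strict _≤_ a b = a ≤ b × ¬ (b ≤ a)

-- IsTotalPreorder _≈_ includes compatibility of _≤_ with _≈_, so _≤_ is a relation on classes.
record Restricting {c ℓ ℓ′} (S : RawSemiring c ℓ)
                   (_≤_ : Rel (RawSemiring.Carrier S) ℓ′) : Set (c ⊔ ℓ ⊔ ℓ′) where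
  open RawSemiring S

  _<_ : Rel Carrier ℓ′
  _<_ = Strict _≤_

  field
    isTotalPreorder : IsTotalPreorder _≈_ _≤_
    <-*             : ∀ a b c → c ≉ 0# → a < b → a < (b * c)
    <-+             : ∀ a b c → a < b → a < (b + c)
    -- Finitely many classes: finitely many representatives cover the down-set.
    finiteBelow     : ∀ a → ∃[ bs ] (∀ b → b ≤ a → Anyˡ (b ≈_) bs)

Restrictive : ∀ {V ℓ} (ℓ′ : Level) (E : EquationalTheory V ℓ) → Monoidal E → V → Set (ℓ ⊔ lsuc ℓ′)
Restrictive ℓ′ E M x = Σ (Rel (RawSemiring.Carrier (𝒮 E M x)) ℓ′) (Restricting (𝒮 E M x))

{-# OPTIONS --safe #-}
module Submission where

-- A substitution is a matrix over the semiring of E, with one column for each variable, and σ ≤ τ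
-- says that the columns of τ are combinations of those of σ.  Along a descending chain these column
-- spans increase.  Let W be a finite set of variables such that σ₀ is the identity outside W and maps
-- W to terms over W.  Every later span contains the vectors vanishing on W, and at most |W| columns
-- of a later σᵢ are nonzero on W.
-- Suppose columns g₁,…,gₖ, nonzero on W, occur in infinitely many σᵢ.  If together with the vectors
-- vanishing on W they generate every column of the chain, then σᵢ ≤ σᵢ₊₁ for some i, a contradiction.
-- Otherwise let m be a column which they do not generate: to express m, each later σⱼ containing the
-- gₗ needs a further column that is nonzero on W, whose entries are ≤ those of m because E is
-- restrictive.  There are finitely many such columns, so one of them serves as gₖ₊₁ for infinitely
-- many j.  Hence k grows beyond |W|.  Case distinctions are classical, the goal being a negation.

open import Algebra.Bundles using (CommutativeMonoid; RawSemiring)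
import Algebra.Properties.CommutativeSemigroup as CommutativeSemigroupProperties
open import Data.Empty using (⊥)
open import Data.List using (List; []; _∷_; _++_; length; map; filter; deduplicate; cartesianProductWith)
open import Data.List.Membership.Propositional using (_∈_; _∉_; find; lose)
import Data.List.Membership.DecPropositional as DecMembership
open import Data.List.Membership.Propositional.Properties
  using (∈-++⁺ˡ; ∈-++⁺ʳ; ∈-++⁻; ∈-∃++; ∈-deduplicate⁺; ∈-filter⁺; ∈-filter⁻; ∈-map⁻)
open import Data.List.Properties using (length-++; length-map)
open import Data.List.Relation.Binary.Pointwise as Pointwiseˡ using ([]; _∷_) renaming (Pointwise to Pointwiseˡ)
open import Data.List.Relation.Unary.All as All using (All; []; _∷_)
open import Data.List.Relation.Unary.All.Properties using (¬Any⇒All¬)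
open import Data.List.Relation.Unary.AllPairs using ([]; _∷_)
open import Data.List.Relation.Unary.Any as Any using (here; there) renaming (Any to Anyˡ)
open import Data.List.Relation.Unary.Any.Properties using (cartesianProductWith⁺)
open import Data.List.Relation.Unary.Unique.Propositional using (Unique)
open import Data.List.Relation.Unary.Unique.Propositional.Properties using (++⁺; filter⁺)
import Data.List.Relation.Unary.Unique.DecPropositional.Properties as DecUnique
open import Data.Nat using (ℕ; zero; suc; _+_; _≤_; _<_; _⊔_; z≤n; s≤s)
open import Data.Nat.Properties
  using (+-suc; +-identityʳ; +-cancelʳ-≤; ≤-trans; ≤-reflexive; <⇒≱; m≤m⊔n; m≤n⊔m; m∸n+n≡m; module ≤-Reasoning)
open import Data.Product using (∃-syntax; _×_; _,_; proj₁; proj₂)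
open import Data.Sum using (_⊎_; inj₁; inj₂; [_,_]′)
open import Data.Vec using (Vec; []; _∷_)
open import Data.Vec.Relation.Binary.Pointwise.Inductive using (Pointwise; []; _∷_)
open import Data.Vec.Relation.Unary.Any using (Any; here; there)
open import Function using (_∘_; case_of_)
open import Function.Bundles using (Inverse)
open import Induction.InfiniteDescent using (InfiniteDescendingSequence)
open import Level using (Level)
open import Relation.Binary.Core using (Rel)
open import Relation.Binary.Definitions using (DecidableEquality)
open import Relation.Binary.PropositionalEquality
  using (_≡_; _≢_; refl; sym; trans; cong; cong₂; subst; subst₂)
open import Relation.Binary.Structures using (IsTotalPreorder)
open import Relation.Nullary using (¬_; Dec; yes; no; contradiction)
open import Relation.Nullary.Decidable using (map′; _⊎-dec_; ¬?)
open import Relation.Unary using (Pred; _⊆_; ｛_｝)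
open import Defs

private
  variable
    a b p : Level

-- Finite lists

module _ {A : Set a} where

  Unique-⊆⇒length-≤ : ∀ {xs ys : List A} → Unique xs → (∀ {z} → z ∈ xs → z ∈ ys) → length xs ≤ length ys
  Unique-⊆⇒length-≤ [] _ = z≤n
  Unique-⊆⇒length-≤ {x ∷ xs} (x∉xs ∷ xs!) xs⊆ys with ∈-∃++ (xs⊆ys (here refl))
  ... | us , vs , refl = begin
    suc (length xs)             ≤⟨ s≤s (Unique-⊆⇒length-≤ xs! xs⊆us++vs) ⟩
    suc (length (us ++ vs))     ≡⟨ cong suc (length-++ us) ⟩
    suc (length us + length vs) ≡⟨ +-suc (length us) (length vs) ⟨
    length us + suc (length vs) ≡⟨ length-++ us ⟨
    length (us ++ x ∷ vs)       ∎
    where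
    open ≤-Reasoning
    xs⊆us++vs : ∀ {z} → z ∈ xs → z ∈ us ++ vs
    xs⊆us++vs z∈xs with ∈-++⁻ us (xs⊆ys (there z∈xs))
    ... | inj₁ z∈us         = ∈-++⁺ˡ z∈us
    ... | inj₂ (there z∈vs) = ∈-++⁺ʳ us z∈vs
    ... | inj₂ (here refl)  = contradiction refl (All.lookup x∉xs z∈xs)

  Unique-map : ∀ {B : Set b} (g : A → B) {xs} → (∀ {x y} → x ∈ xs → y ∈ xs → g x ≡ g y → x ≡ y) →
               Unique xs → Unique (map g xs)
  Unique-map g inj [] = []
  Unique-map g {x ∷ xs} inj (x∉xs ∷ xs!) =
    ¬Any⇒All¬ _ (λ gx∈ → case ∈-map⁻ g gx∈ of λ
      { (y , y∈xs , gx≡gy) → All.lookup x∉xs y∈xs (inj (here refl) (there y∈xs) gx≡gy) })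
    ∷ Unique-map g (λ x∈ y∈ → inj (there x∈) (there y∈)) xs!

  -- Double negation commutes with quantification over a finite list, so finitely many classical
  -- case distinctions can be made at once for a negated goal.
  ¬¬-∀∈ : ∀ {P : A → Set p} xs → (∀ x → x ∈ xs → ¬ ¬ P x) → ¬ ¬ (∀ x → x ∈ xs → P x)
  ¬¬-∀∈ [] _ k = k λ _ ()
  ¬¬-∀∈ (x ∷ xs) h k = h x (here refl) λ px → ¬¬-∀∈ xs (λ y y∈ → h y (there y∈)) λ pxs →
    k λ { y (here refl) → px ; y (there y∈) → pxs y y∈ }

-- Predicates that hold infinitely often

InfinitelyOften : Pred ℕ p → Set p
InfinitelyOften P = ∀ N → ¬ ¬ (∃[ i ] N ≤ i × P i)

¬InfinitelyOften⇒eventually¬ : {P : Pred ℕ p} → ¬ InfinitelyOften P → ¬ ¬ (∃[ N ] (∀ i → N ≤ i → ¬ P i))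
¬InfinitelyOften⇒eventually¬ ¬inf k = ¬inf λ N none → k (N , λ i N≤i pi → none (i , N≤i , pi))

-- If each `Q c` eventually fails, all of them fail beyond one common bound, while `P` still holds
-- somewhere beyond that bound and `N`.
InfinitelyOften-pigeonhole : {C : Set a} {P : Pred ℕ p} {Q : C → Pred ℕ p} (cs : List C) (N : ℕ) →
  (∀ i → N ≤ i → P i → ¬ ¬ Anyˡ (λ c → Q c i) cs) →
  InfinitelyOften P → ¬ (∀ c → ¬ InfinitelyOften (Q c))
InfinitelyOften-pigeonhole {P = P} {Q} cs N cover inf none = eventually-none cs λ (N′ , none′) →
  inf (N ⊔ N′) λ (i , N⊔N′≤i , pi) →
    cover i (≤-trans (m≤m⊔n N N′) N⊔N′≤i) pi (none′ i (≤-trans (m≤n⊔m N N′) N⊔N′≤i))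
  where
  eventually-none : ∀ cs → ¬ ¬ (∃[ N ] (∀ i → N ≤ i → ¬ Anyˡ (λ c → Q c i) cs))
  eventually-none []       k = k (0 , λ _ _ ())
  eventually-none (c ∷ cs) k =
    ¬InfinitelyOften⇒eventually¬ (none c) λ (N₁ , none₁) → eventually-none cs λ (N₂ , none₂) →
      k (N₁ ⊔ N₂ , λ { i ≤i (here q)   → none₁ i (≤-trans (m≤m⊔n N₁ N₂) ≤i) q
                     ; i ≤i (there qs) → none₂ i (≤-trans (m≤n⊔m N₁ N₂) ≤i) qs })

-- Substitution and the induced congruence

module _ {𝕊 : Signature} {V : Set} where

  ∈Var-[]⁺ : ∀ {t : Term 𝕊 V} {σ y z} → z ∈Var t → y ∈Var σ z → y ∈Var t [ σ ]
  ∈Var-[]*⁺ : ∀ {n} {ts : Vec (Term 𝕊 V) n} {σ y z} →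
              Any (z ∈Var_) ts → y ∈Var σ z → Any (y ∈Var_) (ts [ σ ]*)
  ∈Var-[]⁺ here      y∈ = y∈
  ∈Var-[]⁺ (arg z∈)  y∈ = arg (∈Var-[]*⁺ z∈ y∈)
  ∈Var-[]*⁺ (here z∈)  y∈ = here (∈Var-[]⁺ z∈ y∈)
  ∈Var-[]*⁺ (there z∈) y∈ = there (∈Var-[]*⁺ z∈ y∈)

  []-∘ : ∀ (t : Term 𝕊 V) σ τ → t [ σ ] [ τ ] ≡ t [ (λ v → σ v [ τ ]) ]
  []*-∘ : ∀ {n} (ts : Vec (Term 𝕊 V) n) σ τ → ts [ σ ]* [ τ ]* ≡ ts [ (λ v → σ v [ τ ]) ]*
  []-∘ (var x)    σ τ = refl
  []-∘ (app g ts) σ τ = cong (app g) ([]*-∘ ts σ τ)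
  []*-∘ []       σ τ = refl
  []*-∘ (t ∷ ts) σ τ = cong₂ _∷_ ([]-∘ t σ τ) ([]*-∘ ts σ τ)

  []-var : ∀ (t : Term 𝕊 V) → t [ var ] ≡ t
  []*-var : ∀ {n} (ts : Vec (Term 𝕊 V) n) → ts [ var ]* ≡ ts
  []-var (var x)    = refl
  []-var (app g ts) = cong (app g) ([]*-var ts)
  []*-var []       = refl
  []*-var (t ∷ ts) = cong₂ _∷_ ([]-var t) ([]*-var ts)

  variables  : ∀ (t : Term 𝕊 V) → ∃[ vs ] (∀ {v} → v ∈Var t → v ∈ vs)
  variables* : ∀ {n} (ts : Vec (Term 𝕊 V) n) → ∃[ vs ] (∀ {v} → Any (v ∈Var_) ts → v ∈ vs)
  variables (var x)    = (x ∷ []) , λ { here → here refl }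
  variables (app g ts) with variables* ts
  ... | vs , covers = vs , λ { (arg v∈) → covers v∈ }
  variables* []       = [] , λ ()
  variables* (t ∷ ts) with variables t | variables* ts
  ... | us , covers | vs , covers* =
    us ++ vs , λ { (here v∈) → ∈-++⁺ˡ (covers v∈) ; (there v∈) → ∈-++⁺ʳ us (covers* v∈) }

module _ {ℓ} {V : Set} (E : EquationalTheory V ℓ) where
  open EquationalTheory E

  ≈-[] : ∀ {s t} → s ≈ᴱ t → ∀ σ → s [ σ ] ≈ᴱ t [ σ ]
  ≈-[]* : ∀ {n} {ss ts : Vec (Term 𝕊 V) n} → Pointwise _≈ᴱ_ ss ts → ∀ σ → Pointwise _≈ᴱ_ (ss [ σ ]*) (ts [ σ ]*)
  ≈-[] (axiom {s} {t} e τ) σ = subst₂ _≈ᴱ_ (sym ([]-∘ s τ σ)) (sym ([]-∘ t τ σ)) (axiom e (λ v → τ v [ σ ]))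
  ≈-[] ≈-refl        σ = ≈-refl
  ≈-[] (≈-sym e)     σ = ≈-sym (≈-[] e σ)
  ≈-[] (≈-trans d e) σ = ≈-trans (≈-[] d σ) (≈-[] e σ)
  ≈-[] (≈-cong g es) σ = ≈-cong g (≈-[]* es σ)
  ≈-[]* []       σ = []
  ≈-[]* (e ∷ es) σ = ≈-[] e σ ∷ ≈-[]* es σ

  ≈-reflexive : ∀ {s t} → s ≡ t → s ≈ᴱ t
  ≈-reflexive refl = ≈-refl

  []-cong : ∀ t {σ τ} → (∀ v → v ∈Var t → σ v ≈ᴱ τ v) → t [ σ ] ≈ᴱ t [ τ ]
  []*-cong : ∀ {n} (ts : Vec (Term 𝕊 V) n) {σ τ} → (∀ v → Any (v ∈Var_) ts → σ v ≈ᴱ τ v) →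
             Pointwise _≈ᴱ_ (ts [ σ ]*) (ts [ τ ]*)
  []-cong (var x)    h = h x here
  []-cong (app g ts) h = ≈-cong g ([]*-cong ts λ v v∈ → h v (arg v∈))
  []*-cong []       h = []
  []*-cong (t ∷ ts) h = []-cong t (λ v v∈ → h v (here v∈)) ∷ []*-cong ts (λ v v∈ → h v (there v∈))

  module _ (regular : Regular E) where

    -- Instances of a regular identity have the same variables on both sides, and all closure rules
    -- preserve this.
    Var-≈  : ∀ {s t} → s ≈ᴱ t → Var s ⊆ Var t × Var t ⊆ Var s
    Var-≈* : ∀ {n} {ss ts : Vec (Term 𝕊 V) n} → Pointwise _≈ᴱ_ ss ts →
             (∀ {v} → Any (v ∈Var_) ss → Any (v ∈Var_) ts) × (∀ {v} → Any (v ∈Var_) ts → Any (v ∈Var_) ss)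
    Var-≈ (axiom {s} {t} e σ) =
      (λ v∈ → case ∈Var-[] s σ v∈ of λ { (z , z∈s , v∈σz) → ∈Var-[]⁺ (proj₁ (regular e) z∈s) v∈σz }) ,
      (λ v∈ → case ∈Var-[] t σ v∈ of λ { (z , z∈t , v∈σz) → ∈Var-[]⁺ (proj₂ (regular e) z∈t) v∈σz })
    Var-≈ ≈-refl        = (λ v∈ → v∈) , (λ v∈ → v∈)
    Var-≈ (≈-sym e)     = proj₂ (Var-≈ e) , proj₁ (Var-≈ e)
    Var-≈ (≈-trans d e) = proj₁ (Var-≈ e) ∘ proj₁ (Var-≈ d) , proj₂ (Var-≈ d) ∘ proj₂ (Var-≈ e)
    Var-≈ (≈-cong g es) = (λ { (arg v∈) → arg (proj₁ (Var-≈* es) v∈) }) , (λ { (arg v∈) → arg (proj₂ (Var-≈* es) v∈) })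
    Var-≈* []       = (λ ()) , (λ ())
    Var-≈* (e ∷ es) =
      (λ { (here v∈) → here (proj₁ (Var-≈ e) v∈) ; (there v∈) → there (proj₁ (Var-≈* es) v∈) }) ,
      (λ { (here v∈) → here (proj₂ (Var-≈ e) v∈) ; (there v∈) → there (proj₂ (Var-≈* es) v∈) })

    ∈Var-≈ : ∀ {s t v} → s ≈ᴱ t → v ∈Var s → v ∈Var t
    ∈Var-≈ e = proj₁ (Var-≈ e)

-- Patched functions and finite choice

module _ {A : Set a} (_≟_ : DecidableEquality A) {B : Set b} where
  open DecMembership _≟_ using (_∈?_)

  patch : List A → (A → B) → (A → B) → A → B
  patch X g h v with v ∈? X
  ... | yes _ = g v
  ... | no  _ = h v

  patch-∈ : ∀ {X g h v} → v ∈ X → patch X g h v ≡ g v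
  patch-∈ {X} {v = v} v∈ with v ∈? X
  ... | yes _  = refl
  ... | no  v∉ = contradiction v∈ v∉

  patch-∉ : ∀ {X g h v} → v ∉ X → patch X g h v ≡ h v
  patch-∉ {X} {v = v} v∉ with v ∈? X
  ... | yes v∈ = contradiction v∈ v∉
  ... | no  _  = refl

  choices : (A → List B) → (A → B) → List A → List (A → B)
  choices bs d []      = d ∷ []
  choices bs d (x ∷ X) = cartesianProductWith (λ b → patch (x ∷ []) (λ _ → b)) (bs x) (choices bs d X)

  choices⁺ : ∀ {bs d} {R : A → B → Set p} X → (∀ x → x ∈ X → Anyˡ (R x) (bs x)) →
             Anyˡ (λ c → ∀ x → x ∈ X → R x (c x)) (choices bs d X)
  choices⁺ [] _ = here λ _ ()
  choices⁺ {R = R} (x ∷ X) h =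
    cartesianProductWith⁺ _ extend (h x (here refl)) (choices⁺ X λ y y∈ → h y (there y∈))
    where
    extend : ∀ {b c} → R x b → (∀ y → y ∈ X → R y (c y)) → ∀ y → y ∈ x ∷ X → R y (patch (x ∷ []) (λ _ → b) c y)
    extend Rxb Rc y y∈ with y ∈? (x ∷ [])
    ... | yes (here refl) = Rxb
    ... | no  y≢x with y∈
    ...   | here y≡x  = contradiction (here y≡x) y≢x
    ...   | there y∈X = Rc y y∈X

-- Terms over a monoidal theory

module MonoidalTheory {ℓ} {V : Set} (E : EquationalTheory V ℓ) (M : Monoidal E) where
  open EquationalTheory E
  open Monoidal M
  open DecMembership _≟ⱽ_ using (_∈?_)

  term-induction : (P : Term 𝕊 V → Set p) → (∀ v → P (var v)) → P 𝟘 → (∀ s t → P s → P t → P (f s t)) →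
                   (∀ h t → P t → P (app h (t ∷ []))) → ∀ t → P t
  term-induction P P-var P-𝟘 P-f P-h = go
    where
    go : ∀ t → P t
    go (var v) = P-var v
    go (app g ts) with others g
    go (app _ [])           | inj₁ refl        = P-𝟘
    go (app _ (s ∷ t ∷ [])) | inj₂ (inj₁ refl) = P-f s t (go s) (go t)
    go (app g (t ∷ []))     | inj₂ (inj₂ refl) = P-h g t (go t)

  private
    pick : Term 𝕊 V → Term 𝕊 V → Term 𝕊 V → ℕ → Term 𝕊 V
    pick s t u 0             = s
    pick s t u 1             = t
    pick s t u (suc (suc _)) = u

  -- The identities of a monoidal theory are stated for variables; this transports them to terms.
  instantiate : (P : Term 𝕊 V → Term 𝕊 V → Term 𝕊 V → Set ℓ) →
                (∀ x y z (σ : V → Term 𝕊 V) → P (σ x) (σ y) (σ z)) → ∀ s t u → P s t u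
  instantiate P h s t u = at 0 λ eq₀ → at 1 λ eq₁ → at 2 λ eq₂ →
    transport eq₀ eq₁ eq₂ (h (from 0) (from 1) (from 2) (pick s t u ∘ to))
    where
    open Inverse countable using (to; from; strictlyInverseˡ)
    at : ∀ n → {R : Set ℓ} → (pick s t u (to (from n)) ≡ pick s t u n → R) → R
    at n k = k (cong (pick s t u) (strictlyInverseˡ n))
    transport : ∀ {s s′ t t′ u u′} → s ≡ s′ → t ≡ t′ → u ≡ u′ → P s t u → P s′ t′ u′
    transport refl refl refl p = p

  f-cong : ∀ {s s′ t t′} → s ≈ᴱ s′ → t ≈ᴱ t′ → f s t ≈ᴱ f s′ t′
  f-cong d e = ≈-cong plusᴱ (d ∷ e ∷ [])

  f-identityʳ : ∀ s → f s 𝟘 ≈ᴱ s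
  f-identityʳ s = instantiate (λ s _ _ → f s 𝟘 ≈ᴱ s) (λ x _ _ → ≈-[] E (f-unit x)) s s s

  f-commutative : ∀ s t → f s t ≈ᴱ f t s
  f-commutative s t = instantiate (λ s t _ → f s t ≈ᴱ f t s) (λ x y _ → ≈-[] E (f-comm x y)) s t t

  +-commutativeMonoid : CommutativeMonoid _ _
  +-commutativeMonoid = record
    { Carrier = Term 𝕊 V ; _≈_ = _≈ᴱ_ ; _∙_ = f ; ε = 𝟘
    ; isCommutativeMonoid = record
      { isMonoid = record
        { isSemigroup = record
          { isMagma = record
            { isEquivalence = record { refl = ≈-refl ; sym = ≈-sym ; trans = ≈-trans }
            ; ∙-cong = f-cong }
          ; assoc = λ s t u → ≈-sym (instantiate (λ s t u → f s (f t u) ≈ᴱ f (f s t) u)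
                                      (λ x y z → ≈-[] E (f-assoc x y z)) s t u) }
        ; identity = (λ s → ≈-trans (f-commutative 𝟘 s) (f-identityʳ s)) , f-identityʳ }
      ; comm = f-commutative } }

  open CommutativeMonoid +-commutativeMonoid public
    using (setoid; commutativeSemigroup) renaming (identityˡ to f-identityˡ)
  open CommutativeSemigroupProperties commutativeSemigroup using (interchange)

  app-f : ∀ h s t → app h (f s t ∷ []) ≈ᴱ f (app h (s ∷ [])) (app h (t ∷ []))
  app-f h s t = instantiate (λ s t _ → app h (f s t ∷ []) ≈ᴱ f (app h (s ∷ [])) (app h (t ∷ [])))
                            (λ x y _ → ≈-[] E (hom-f h x y)) s t t

  -- All function symbols commute with addition: `interchange` settles `f`, the homomorphism law the
  -- unary symbols. So a term acts linearly on vectors, as a row of a matrix.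
  []-f : ∀ t σ τ → t [ (λ v → f (σ v) (τ v)) ] ≈ᴱ f (t [ σ ]) (t [ τ ])
  []-f t σ τ = term-induction (λ t → t [ (λ v → f (σ v) (τ v)) ] ≈ᴱ f (t [ σ ]) (t [ τ ]))
    (λ _ → ≈-refl)
    (≈-sym (f-identityʳ 𝟘))
    (λ s t s≈ t≈ → ≈-trans (f-cong s≈ t≈) (interchange _ _ _ _))
    (λ h t t≈ → ≈-trans (≈-cong h (t≈ ∷ [])) (app-f h _ _))
    t

  []-𝟘 : ∀ t {σ} → (∀ v → v ∈Var t → σ v ≈ᴱ 𝟘) → t [ σ ] ≈ᴱ 𝟘
  []-𝟘 t {σ} σ≈𝟘 = ≈-trans ([]-cong E t σ≈𝟘) (all-𝟘 t)
    where
    all-𝟘 : ∀ t → t [ (λ _ → 𝟘) ] ≈ᴱ 𝟘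
    all-𝟘 = term-induction (λ t → t [ (λ _ → 𝟘) ] ≈ᴱ 𝟘)
      (λ _ → ≈-refl)
      ≈-refl
      (λ s t s≈ t≈ → ≈-trans (f-cong s≈ t≈) (f-identityʳ 𝟘))
      (λ h t t≈ → ≈-trans (≈-cong h (t≈ ∷ [])) (hom-𝟘 h))

  -- With regularity, a term is therefore nonzero exactly when some variable occurs in it: a
  -- syntactic test that does not require deciding `_≈ᴱ_`.
  ground⇒≈𝟘 : ∀ t → (∀ v → ¬ (v ∈Var t)) → t ≈ᴱ 𝟘
  ground⇒≈𝟘 t ground = subst (_≈ᴱ 𝟘) ([]-var t) ([]-𝟘 t λ v v∈ → contradiction v∈ (ground v))

  _∈Var?_ : ∀ x t → Dec (x ∈Var t)
  x ∈Var? t = term-induction (λ t → Dec (x ∈Var t))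
    (λ v → map′ (λ { refl → here }) (λ { here → refl }) (x ≟ⱽ v))
    (no λ { (arg ()) })
    (λ s t s? t? → map′ [ (λ x∈ → arg (here x∈)) , (λ x∈ → arg (there (here x∈))) ]′
                        (λ { (arg (here x∈)) → inj₁ x∈ ; (arg (there (here x∈))) → inj₂ x∈ }) (s? ⊎-dec t?))
    (λ h t t? → map′ (λ x∈ → arg (here x∈)) (λ { (arg (here x∈)) → x∈ }) t?)
    t

  ≡var? : ∀ (t : Term 𝕊 V) x → Dec (t ≡ var x)
  ≡var? (var y)    x = map′ (cong var) (λ { refl → refl }) (y ≟ⱽ x)
  ≡var? (app _ _)  x = no λ ()

  -- As a matrix, `σ` is block diagonal: a finite block on `W` and the identity outside.
  Stable : (V → Term 𝕊 V) → List V → Set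
  Stable σ W = (∀ {v} → v ∉ W → σ v ≡ var v) × (∀ {u v} → u ∈ W → v ∈Var σ u → v ∈ W)

  Stable-⊇ : ∀ {σ W W′} → Stable σ W → (∀ {v} → v ∈ W → v ∈ W′) → Stable σ W′
  Stable-⊇ {σ} {W} {W′} (fix , closed) W⊆W′ = (λ v∉W′ → fix (v∉W′ ∘ W⊆W′)) , closed′
    where
    closed′ : ∀ {u v} → u ∈ W′ → v ∈Var σ u → v ∈ W′
    closed′ {u} u∈W′ v∈ with u ∈? W
    ... | yes u∈W = W⊆W′ (closed u∈W v∈)
    ... | no  u∉W with subst (_ ∈Var_) (fix u∉W) v∈
    ...   | here = u∈W′

  stabilise : (σ : Substitution 𝕊 V) → ∃[ W ] Stable (fun σ) W
  stabilise σ = xs ++ proj₁ (range xs) , fix , closed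
    where
    xs = proj₁ (Substitution.finiteDomain σ)
    range : ∀ us → ∃[ vs ] (∀ {u v} → u ∈ us → v ∈Var fun σ u → v ∈ vs)
    range [] = [] , λ ()
    range (u ∷ us) with variables (fun σ u) | range us
    ... | vs , covers | ws , covers* =
      vs ++ ws , λ { (here refl) v∈ → ∈-++⁺ˡ (covers v∈) ; (there u∈) v∈ → ∈-++⁺ʳ vs (covers* u∈ v∈) }
    fix : ∀ {v} → v ∉ xs ++ proj₁ (range xs) → fun σ v ≡ var v
    fix {v} v∉ with ≡var? (fun σ v) v
    ... | yes σv≡v = σv≡v
    ... | no  σv≢v = contradiction (∈-++⁺ˡ (proj₂ (Substitution.finiteDomain σ) v σv≢v)) v∉
    closed : ∀ {u v} → u ∈ xs ++ proj₁ (range xs) → v ∈Var fun σ u → v ∈ xs ++ proj₁ (range xs)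
    closed {u} u∈ v∈ with ≡var? (fun σ u) u
    ... | no  σu≢u = ∈-++⁺ʳ xs (proj₂ (range xs) (proj₂ (Substitution.finiteDomain σ) u σu≢u) v∈)
    ... | yes σu≡u with subst (_ ∈Var_) σu≡u v∈
    ...   | here = u∈

  -- m is a right linear combination of the columns of the matrix σ.
  record Span (σ m : V → Term 𝕊 V) : Set ℓ where
    constructor _,_
    field
      coefficients : V → Term 𝕊 V
      combination  : ∀ y → σ y [ coefficients ] ≈ᴱ m y

  open Span public

  Span-trans : ∀ {σ τ m} → Span σ τ → Span τ m → Span σ m
  Span-trans {σ} (ρ , σρ≈τ) (θ , τθ≈m) = (λ v → ρ v [ θ ]) , λ y →
    ≈-trans (≈-reflexive E (sym ([]-∘ (σ y) ρ θ))) (≈-trans (≈-[] E (σρ≈τ y) θ) (τθ≈m y))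

  Span-𝟘 : ∀ {σ m} → (∀ y → m y ≈ᴱ 𝟘) → Span σ m
  Span-𝟘 {σ} m≈𝟘 = (λ _ → 𝟘) , λ y → ≈-trans ([]-𝟘 (σ y) (λ _ _ → ≈-refl)) (≈-sym (m≈𝟘 y))

-- Substitutions as matrices

module Matrices {ℓ} {V : Set} (E : EquationalTheory V ℓ) (M : Monoidal E) (x₀ : V) where
  open EquationalTheory E
  open Monoidal M
  open MonoidalTheory E M
  open DecMembership _≟ⱽ_ using (_∈?_)
  open DecUnique _≟ⱽ_ using (deduplicate-!)
  open import Relation.Binary.Reasoning.Setoid setoid

  infixl 8 _⟨_⟩
  _⟨_⟩ : Term 𝕊 V → Term 𝕊 V → Term 𝕊 V
  s ⟨ c ⟩ = s [ _↦_ E x₀ c ]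

  ↦-eq : ∀ c → _↦_ E x₀ c x₀ ≡ c
  ↦-eq c with x₀ ≟ⱽ x₀
  ... | yes _     = refl
  ... | no  x₀≢x₀ = contradiction refl x₀≢x₀

  ∈Var-⟨⟩ : ∀ {s c v} → x₀ ∈Var s → v ∈Var c → v ∈Var s ⟨ c ⟩
  ∈Var-⟨⟩ x₀∈s v∈c = ∈Var-[]⁺ x₀∈s (subst (_ ∈Var_) (sym (↦-eq _)) v∈c)

  OneVar : Term 𝕊 V → Set
  OneVar t = Var t ⊆ ｛ x₀ ｝

  OneVar-[] : ∀ t {τ} → (∀ v → OneVar (τ v)) → OneVar (t [ τ ])
  OneVar-[] t {τ} τ₁ y∈ with ∈Var-[] t τ y∈
  ... | z , _ , y∈τz = τ₁ z y∈τz

  -- The `q`-th unit vector; applying it to a row reads off the coefficient of `q` as an element of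
  -- the semiring.
  e : V → V → Term 𝕊 V
  e q = patch _≟ⱽ_ (q ∷ []) (λ _ → var x₀) (λ _ → 𝟘)

  erase : V → (V → Term 𝕊 V) → V → Term 𝕊 V
  erase q = patch _≟ⱽ_ (q ∷ []) (λ _ → 𝟘)

  column : (V → Term 𝕊 V) → V → V → Term 𝕊 V
  column σ q y = σ y [ e q ]

  OneVar-e : ∀ q v → OneVar (e q v)
  OneVar-e q v y∈ with v ∈? (q ∷ [])
  OneVar-e q v here     | yes _ = refl
  OneVar-e q v (arg ()) | no  _

  OneVar-erase : ∀ q {τ} → (∀ v → OneVar (τ v)) → ∀ v → OneVar (erase q τ v)
  OneVar-erase q τ₁ v y∈ with v ∈? (q ∷ [])
  OneVar-erase q τ₁ v (arg ()) | yes _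
  OneVar-erase q τ₁ v y∈       | no  _ = τ₁ v y∈

  ∈Var-erase : ∀ q τ {v} → x₀ ∈Var erase q τ v → v ≢ q × x₀ ∈Var τ v
  ∈Var-erase q τ {v} x₀∈ with v ∈? (q ∷ [])
  ∈Var-erase q τ {v} (arg ()) | yes _
  ∈Var-erase q τ {v} x₀∈      | no  v∉ = v∉ ∘ here , x₀∈

  -- Linearity, after writing `τ` as the unit vector `e q` times its `q`-entry plus the rest. This
  -- peels one column off a linear combination.
  []-split : ∀ t q τ → t [ τ ] ≈ᴱ f (t [ e q ] ⟨ τ q ⟩) (t [ erase q τ ])
  []-split t q τ = begin
    t [ τ ]                                                  ≈⟨ []-cong E t (λ v _ → at v) ⟩
    t [ (λ v → f (e q v ⟨ τ q ⟩) (erase q τ v)) ]             ≈⟨ []-f t _ _ ⟩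
    f (t [ (λ v → e q v ⟨ τ q ⟩) ]) (t [ erase q τ ])         ≡⟨ cong (λ s → f s (t [ erase q τ ])) ([]-∘ t _ _) ⟨
    f (t [ e q ] ⟨ τ q ⟩) (t [ erase q τ ])                   ∎
    where
    at : ∀ v → τ v ≈ᴱ f (e q v ⟨ τ q ⟩) (erase q τ v)
    at v with v ∈? (q ∷ [])
    ... | yes (here refl) = ≈-sym (≈-trans (f-identityʳ _) (≈-reflexive E (↦-eq (τ v))))
    ... | no  _           = ≈-sym (f-identityˡ (τ v))

  Span-f : ∀ {σ m m′ n} c → Span σ m → Span σ m′ → (∀ y → n y ≈ᴱ f (m y ⟨ c ⟩) (m′ y)) → Span σ n
  Span-f {σ} {m} {m′} {n} c (ρ , σρ≈m) (ρ′ , σρ′≈m′) n≈ = (λ v → f (ρ v ⟨ c ⟩) (ρ′ v)) , λ y → begin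
    σ y [ (λ v → f (ρ v ⟨ c ⟩) (ρ′ v)) ]       ≈⟨ []-f (σ y) _ _ ⟩
    f (σ y [ (λ v → ρ v ⟨ c ⟩) ]) (σ y [ ρ′ ])  ≡⟨ cong (λ s → f s (σ y [ ρ′ ])) ([]-∘ (σ y) _ _) ⟨
    f (σ y [ ρ ] ⟨ c ⟩) (σ y [ ρ′ ])            ≈⟨ f-cong (≈-[] E (σρ≈m y) _) (σρ′≈m′ y) ⟩
    f (m y ⟨ c ⟩) (m′ y)                        ≈⟨ n≈ y ⟨
    n y                                         ∎

  -- Renaming all variables of the coefficients to `x₀` leaves `m` unchanged and brings the
  -- coefficients into the semiring, where the restricting order lives.
  Span-OneVar : ∀ {σ m} → (∀ y → OneVar (m y)) → Span σ m →
                ∃[ τ ] (∀ v → OneVar (τ v)) × (∀ y → σ y [ τ ] ≈ᴱ m y)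
  Span-OneVar {σ} {m} m₁ (ρ , σρ≈m) =
    (λ v → ρ v [ (λ _ → var x₀) ]) , (λ v → OneVar-[] (ρ v) λ { _ here → refl }) , λ y → begin
      σ y [ (λ v → ρ v [ (λ _ → var x₀) ]) ]  ≡⟨ []-∘ (σ y) _ _ ⟨
      σ y [ ρ ] [ (λ _ → var x₀) ]           ≈⟨ ≈-[] E (σρ≈m y) _ ⟩
      m y [ (λ _ → var x₀) ]                 ≈⟨ []-cong E (m y) (λ v v∈ → ≈-reflexive E (cong var (m₁ y v∈))) ⟩
      m y [ var ]                            ≡⟨ []-var (m y) ⟩
      m y                                    ∎

  Span-columns : ∀ {σ σ′} Z {τ} → (∀ q → q ∈ Z → Span σ (column σ′ q)) → (∀ v → v ∉ Z → τ v ≈ᴱ 𝟘) →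
                 Span σ (λ y → σ′ y [ τ ])
  Span-columns {σ′ = σ′} [] cols τ≈𝟘 = Span-𝟘 λ y → []-𝟘 (σ′ y) λ v _ → τ≈𝟘 v λ ()
  Span-columns {σ} {σ′} (q ∷ Z) {τ} cols τ≈𝟘 =
    Span-f (τ q) (cols q (here refl)) (Span-columns {σ} {σ′} Z (λ q′ q′∈ → cols q′ (there q′∈)) erase≈𝟘)
           (λ y → []-split (σ′ y) q τ)
    where
    erase≈𝟘 : ∀ v → v ∉ Z → erase q τ v ≈ᴱ 𝟘
    erase≈𝟘 v v∉Z with v ∈? (q ∷ [])
    ... | yes _  = ≈-refl
    ... | no  v∉ = τ≈𝟘 v λ { (here refl) → v∉ (here refl) ; (there v∈Z) → v∉Z v∈Z }

  -- The coefficient vector need not have a finite domain, so it is replaced by the identity outside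
  -- `Z`. Stability hides the change: rows in `Z` use only variables of `Z`, and both matrices are
  -- the identity on the other rows.
  columns⇒≤ᴱ : ∀ (σ σ′ : Substitution 𝕊 V) {Z} → Stable (fun σ) Z → Stable (fun σ′) Z →
               (∀ q → q ∈ Z → Span (fun σ) (column (fun σ′) q)) → _≤ᴱ_ E σ σ′
  columns⇒≤ᴱ σ σ′ {Z} (fix , closed) (fix′ , closed′) cols =
    record { fun = patch _≟ⱽ_ Z ρ var ; finiteDomain = Z , domain } , λ y → instance-of y (y ∈? Z)
    where
    -- The identity on `Z`, cut to zero elsewhere, reproduces the rows of `σ′` in `Z` from finitely
    -- many columns.
    ρ,σρ≈ = Span-columns {σ′ = fun σ′} Z {patch _≟ⱽ_ Z var (λ _ → 𝟘)} cols (λ v v∉ → ≈-reflexive E (patch-∉ _≟ⱽ_ v∉))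
    ρ = coefficients ρ,σρ≈
    domain : ∀ x → patch _≟ⱽ_ Z ρ var x ≢ var x → x ∈ Z
    domain x ≢x with x ∈? Z
    ... | yes x∈Z = x∈Z
    ... | no  _   = contradiction refl ≢x
    instance-of : ∀ y → Dec (y ∈ Z) → fun σ y [ patch _≟ⱽ_ Z ρ var ] ≈ᴱ fun σ′ y
    instance-of y (no y∉Z) rewrite fix y∉Z | fix′ y∉Z = ≈-reflexive E (patch-∉ _≟ⱽ_ y∉Z)
    instance-of y (yes y∈Z) = begin
      fun σ y [ patch _≟ⱽ_ Z ρ var ]
        ≈⟨ []-cong E (fun σ y) (λ v v∈ → ≈-reflexive E (patch-∈ _≟ⱽ_ (closed y∈Z v∈))) ⟩
      fun σ y [ ρ ]
        ≈⟨ combination ρ,σρ≈ y ⟩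
      fun σ′ y [ patch _≟ⱽ_ Z var (λ _ → 𝟘) ]
        ≈⟨ []-cong E (fun σ′ y) (λ v v∈ → ≈-reflexive E (patch-∈ _≟ⱽ_ (closed′ y∈Z v∈))) ⟩
      fun σ′ y [ var ]
        ≡⟨ []-var (fun σ′ y) ⟩
      fun σ′ y
        ∎

  -- Columns that are nonzero on `W`

  module Shared (regular : Regular E) {σ₀ : V → Term 𝕊 V} {W : List V} (stable₀ : Stable σ₀ W) where

    -- By regularity, these are the columns with a nonzero entry in a row of `W`.
    Shared : (V → Term 𝕊 V) → V → Set
    Shared σ q = ∃[ u ] u ∈ W × q ∈Var σ u

    -- If R ∘ σ ≈ σ₀, a variable x outside W satisfies R (σ x) ≈ x, so σ x contains a variable j x
    -- with x in R (j x).  The variables j x are pairwise distinct and never shared, so in a finite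
    -- stable set W ∪ A those with x in A leave room for at most |W| shared ones.
    length-shared : ∀ {σ Z} → Stable σ Z → Span σ σ₀ →
                    ∀ {qs} → Unique qs → All (Shared σ) qs → length qs ≤ length W
    length-shared {σ} {Z} stable (R , σR≈σ₀) {qs} qs! shared = +-cancelʳ-≤ (length A) (length qs) (length W) counts
      where
      A? = λ v → ¬? (v ∈? W)
      A = filter A? (deduplicate _≟ⱽ_ Z)

      ∈A⇒∉W : ∀ {v} → v ∈ A → v ∉ W
      ∈A⇒∉W v∈A = proj₂ (∈-filter⁻ A? {xs = deduplicate _≟ⱽ_ Z} v∈A)

      Z⊆W++A : ∀ {v} → v ∈ Z → v ∈ W ++ A
      Z⊆W++A {v} v∈Z with v ∈? W
      ... | yes v∈W = ∈-++⁺ˡ v∈W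
      ... | no  v∉W = ∈-++⁺ʳ W (∈-filter⁺ A? (∈-deduplicate⁺ _≟ⱽ_ v∈Z) v∉W)

      ∈Var-composite : ∀ {x y q} → q ∈Var σ y → x ∈Var R q → x ∈Var σ₀ y
      ∈Var-composite {y = y} q∈ x∈ = ∈Var-≈ E regular (σR≈σ₀ y) (∈Var-[]⁺ q∈ x∈)

      closed : ∀ {u v} → u ∈ W ++ A → v ∈Var σ u → v ∈ W ++ A
      closed = proj₂ (Stable-⊇ stable Z⊆W++A)

      private-variable : ∀ x → ∃[ q ] (x ∉ W → q ∈Var σ x × x ∈Var R q)
      private-variable x with x ∈? W
      -- A dummy value that makes `j` total; the guard `x ∉ W` discards it.
      ... | yes x∈W = x , λ x∉W → contradiction x∈W x∉W
      ... | no  x∉W with ∈Var-[] (σ x) R (∈Var-≈ E regular (≈-sym (σR≈σ₀ x))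
                                            (subst (x ∈Var_) (sym (proj₁ stable₀ x∉W)) here))
      ...   | q , q∈ , x∈ = q , λ _ → q∈ , x∈

      j : V → V
      j x = proj₁ (private-variable x)

      j∈ : ∀ {x} → x ∈ A → j x ∈Var σ x
      j∈ {x} x∈A = proj₁ (proj₂ (private-variable x) (∈A⇒∉W x∈A))

      ∈Rj : ∀ {x} → x ∈ A → x ∈Var R (j x)
      ∈Rj {x} x∈A = proj₂ (proj₂ (private-variable x) (∈A⇒∉W x∈A))

      j-injective : ∀ {x y} → x ∈ A → y ∈ A → j x ≡ j y → x ≡ y
      j-injective {x} {y} x∈A y∈A jx≡jy
        with subst (x ∈Var_) (proj₁ stable₀ (∈A⇒∉W y∈A))
               (∈Var-composite (j∈ y∈A) (subst (λ q → x ∈Var R q) jx≡jy (∈Rj x∈A)))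
      ... | here = refl

      j-not-shared : ∀ {q} → ¬ (q ∈ qs × q ∈ map j A)
      j-not-shared (q∈qs , q∈jA) with ∈-map⁻ j q∈jA | All.lookup shared q∈qs
      -- A shared `j x` would put `x` into some `σ₀ u` with `u` in `W`, hence into `W`.
      ... | x , x∈A , refl | u , u∈W , q∈σu =
        ∈A⇒∉W x∈A (proj₂ stable₀ u∈W (∈Var-composite q∈σu (∈Rj x∈A)))

      all-unique : Unique (qs ++ map j A)
      all-unique = ++⁺ qs! (Unique-map j j-injective (filter⁺ A? (deduplicate-! Z))) j-not-shared

      all-in : ∀ {v} → v ∈ qs ++ map j A → v ∈ W ++ A
      all-in v∈ with ∈-++⁻ qs v∈
      ... | inj₁ v∈qs = let u , u∈W , v∈σu = All.lookup shared v∈qs in closed (∈-++⁺ˡ u∈W) v∈σu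
      ... | inj₂ v∈jA with ∈-map⁻ j v∈jA
      ...   | x , x∈A , refl = closed (∈-++⁺ʳ W x∈A) (j∈ x∈A)

      counts : length qs + length A ≤ length W + length A
      counts = subst₂ _≤_ (trans (length-++ qs) (cong (length qs +_) (length-map j A))) (length-++ W)
                 (Unique-⊆⇒length-≤ all-unique all-in)

    -- Combinations of the columns gs, up to a vector that vanishes on W.
    Generated : List (V → OneVarTerm E M x₀) → (V → Term 𝕊 V) → Set ℓ
    Generated []       m = ∀ u → u ∈ W → m u ≈ᴱ 𝟘
    Generated (g ∷ gs) m = ∃[ c ] ∃[ m′ ] Generated gs m′ × (∀ y → m y ≈ᴱ f (proj₁ (g y) ⟨ c ⟩) (m′ y))

    Generated-≈ : ∀ gs {m n} → (∀ y → m y ≈ᴱ n y) → Generated gs m → Generated gs n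
    Generated-≈ []       m≈n m≈𝟘                = λ u u∈W → ≈-trans (≈-sym (m≈n u)) (m≈𝟘 u u∈W)
    Generated-≈ (g ∷ gs) m≈n (c , m′ , gen , m≈) = c , m′ , gen , λ y → ≈-trans (≈-sym (m≈n y)) (m≈ y)

    IsColumn : (V → Term 𝕊 V) → V → (V → OneVarTerm E M x₀) → Set ℓ
    IsColumn σ q g = ∀ y → column σ q y ≈ᴱ proj₁ (g y)

    -- A vector m that vanishes on W is σ₀ m: σ₀ is the identity outside W and maps W to terms over W.
    Generated⇒Span : ∀ {σ qs gs m} → Span σ σ₀ → Pointwiseˡ (IsColumn σ) qs gs → Generated gs m → Span σ m
    Generated⇒Span {m = m} span [] m≈𝟘 = Span-trans span (m , λ y → σ₀m≈m y (y ∈? W))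
      where
      σ₀m≈m : ∀ y → Dec (y ∈ W) → σ₀ y [ m ] ≈ᴱ m y
      σ₀m≈m y (yes y∈W) = ≈-trans ([]-𝟘 (σ₀ y) λ v v∈ → m≈𝟘 v (proj₂ stable₀ y∈W v∈)) (≈-sym (m≈𝟘 y y∈W))
      σ₀m≈m y (no  y∉W) rewrite proj₁ stable₀ y∉W = ≈-refl
    Generated⇒Span {σ} {q ∷ _} span (col ∷ cols) (c , m′ , gen , m≈) =
      Span-f c (e q , col) (Generated⇒Span span cols gen) m≈

    -- The coefficients at `qs` are erased one by one and their columns moved into the generated
    -- part. The remainder either vanishes on `W` or contains `x₀` there; that `x₀` comes from a
    -- coefficient that was not erased, hence from outside `qs`.
    new-column : ∀ {σ qs gs} → Pointwiseˡ (IsColumn σ) qs gs → ∀ τ → (∀ v → OneVar (τ v)) →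
                 (∃[ q ] Shared σ q × q ∉ qs × x₀ ∈Var τ q) ⊎ Generated gs (λ y → σ y [ τ ])
    new-column {σ} [] τ τ₁ with Any.any? (λ u → x₀ ∈Var? (σ u [ τ ])) W
    ... | no  none = inj₂ λ u u∈W → ground⇒≈𝟘 _ λ v v∈ →
      none (lose u∈W (subst (_∈Var σ u [ τ ]) (sym (OneVar-[] (σ u) τ₁ v∈)) v∈))
    ... | yes some with find some
    ...   | u , u∈W , x₀∈ with ∈Var-[] (σ u) τ x₀∈
    ...     | q , q∈ , x₀∈τq = inj₁ (q , (u , u∈W , q∈) , (λ ()) , x₀∈τq)
    new-column {σ} {q ∷ qs} (col ∷ cols) τ τ₁ with new-column cols (erase q τ) (OneVar-erase q τ₁)
    ... | inj₁ (q′ , shared , q′∉ , x₀∈) with ∈Var-erase q τ x₀∈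
    ...   | q′≢q , x₀∈τq′ = inj₁ (q′ , shared , (λ { (here q′≡q) → q′≢q q′≡q ; (there q′∈) → q′∉ q′∈ }) , x₀∈τq′)
    new-column {σ} {q ∷ qs} (col ∷ cols) τ τ₁ | inj₂ gen =
      inj₂ (τ q , _ , gen , λ y → ≈-trans ([]-split (σ y) q τ) (f-cong (≈-[] E (col y) _) ≈-refl))

-- The restricting order and the descending chain

module _ {ℓ ℓ′ : Level} {V : Set} (E : EquationalTheory V ℓ) (M : Monoidal E) (x₀ : V)
         (regular : Regular E) {_≼_ : Rel (OneVarTerm E M x₀) ℓ′} (restricting : Restricting (𝒮 E M x₀) _≼_) where
  open EquationalTheory E
  open Monoidal M
  open MonoidalTheory E M
  open Matrices E M x₀
  open DecMembership _≟ⱽ_ using (_∈?_)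
  open Restricting restricting hiding (_<_)
  open RawSemiring (𝒮 E M x₀) using (Carrier; 0#) renaming (_≈_ to _≈ˢ_; _+_ to _⊕_; _*_ to _⊗_)

  -- Otherwise `m` lies strictly below `a`, hence below `a ⊗ c` and `(a ⊗ c) ⊕ r`, that is, below
  -- itself. Here `c` is nonzero by regularity, since `x₀` occurs in it.
  summand-≼ : ∀ a c r m → x₀ ∈Var proj₁ c → m ≈ˢ (a ⊗ c) ⊕ r → ¬ ¬ (a ≼ m)
  summand-≼ a c r m x₀∈c m≈ac+r a⋠m with IsTotalPreorder.total isTotalPreorder a m
  ... | inj₁ a≼m = a⋠m a≼m
  ... | inj₂ m≼a = proj₂ (<-+ m (a ⊗ c) r (<-* m a c c≉0 (m≼a , a⋠m)))
                     (IsTotalPreorder.reflexive isTotalPreorder (≈-sym m≈ac+r))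
    where
    c≉0 : ¬ (c ≈ˢ 0#)
    c≉0 c≈0 with ∈Var-≈ E regular c≈0 x₀∈c
    ... | arg ()

  module _ (σ : ℕ → Substitution 𝕊 V) (descending : InfiniteDescendingSequence (_<ᴱ_ E) σ) where

    private
      S : ℕ → V → Term 𝕊 V
      S = fun ∘ σ

      W : List V
      W = proj₁ (stabilise (σ 0))

      Z : ℕ → List V
      Z = proj₁ ∘ stabilise ∘ σ

      stable : ∀ i → Stable (S i) (Z i)
      stable = proj₂ ∘ stabilise ∘ σ

    open Shared regular (stable 0)

    -- Each `σ (suc i)` is more general than `σ i`, so whatever `S i` spans is spanned by
    -- `S (suc i)`.
    Span-later : ∀ k {i m} → Span (S i) m → Span (S (k + i)) m
    Span-later zero    span = span
    Span-later (suc k) span with proj₁ (descending _)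
    ... | ρ , Sρ≈S = Span-trans (fun ρ , Sρ≈S) (Span-later k span)

    Span-≤ : ∀ {i j m} → i ≤ j → Span (S i) m → Span (S j) m
    Span-≤ {i} {j} {m} i≤j span = subst (λ j → Span (S j) m) (m∸n+n≡m i≤j) (Span-later _ span)

    Span-σ₀ : ∀ i → Span (S i) (S 0)
    Span-σ₀ i = Span-≤ z≤n (var , λ y → ≈-reflexive E ([]-var _))

    -- The vectors `gs` stay fixed along the chain; only their positions `qs` depend on `i`.
    Has : List (V → Carrier) → ℕ → Set ℓ
    Has gs i = ∃[ qs ] Unique qs × All (Shared (S i)) qs × Pointwiseˡ (IsColumn (S i)) qs gs

    length-Has : ∀ {gs i} → Has gs i → length gs ≤ length W
    length-Has {i = i} (qs , qs! , shared , cols) =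
      subst (_≤ length W) (Pointwiseˡ.Pointwise-length cols) (length-shared (stable i) (Span-σ₀ i) qs! shared)

    module _ (gs : List (V → Carrier)) (i : ℕ) (q₀ : V) (¬generated : ¬ Generated gs (column (S i) q₀)) where

      X : List V
      -- Outside `Z i` the matrix is the identity, so column `q₀` can be nonzero there only in row
      -- `q₀`.
      X = q₀ ∷ Z i

      m : V → Carrier
      m y = column (S i) q₀ y , OneVar-[] (S i y) (OneVar-e q₀)

      candidates : List (V → Carrier)
      candidates = choices _≟ⱽ_ (λ y → proj₁ (finiteBelow (m y))) (λ _ → 0#) X

      m≡𝟘 : ∀ {y} → y ∉ X → proj₁ (m y) ≡ 𝟘
      m≡𝟘 y∉X rewrite proj₁ (stable i) (y∉X ∘ there) =
        patch-∉ _≟ⱽ_ {X = q₀ ∷ []} λ { (here refl) → y∉X (here refl) }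

      -- Zeros are forced outside `X`, so that a match with a column has to be found on `X` only.
      cutoff : (V → Carrier) → V → Carrier
      cutoff c = patch _≟ⱽ_ X c (λ _ → 0#)

      module _ (θ τ : V → Term 𝕊 V) (τ₁ : ∀ v → OneVar (τ v)) (θτ≈m : ∀ y → θ y [ τ ] ≈ᴱ proj₁ (m y))
               {q : V} (x₀∈τq : x₀ ∈Var τ q) where

        entry : V → Carrier
        entry y = column θ q y , OneVar-[] (θ y) (OneVar-e q)

        m≈ : ∀ y → proj₁ (m y) ≈ᴱ f (column θ q y ⟨ τ q ⟩) (θ y [ erase q τ ])
        m≈ y = ≈-trans (≈-sym (θτ≈m y)) ([]-split (θ y) q τ)

        entry-≼ : ∀ y → ¬ ¬ (entry y ≼ m y)
        entry-≼ y = summand-≼ (entry y) (τ q , τ₁ q) rest (m y) x₀∈τq (m≈ y)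
          where
          rest : Carrier
          rest = θ y [ erase q τ ] , OneVar-[] (θ y) (OneVar-erase q τ₁)

        -- Variables never cancel: an `x₀` in the entry would occur in its product with `τ q` and so
        -- in `m y`, which is `𝟘` outside `X`.
        entry≈0 : ∀ {y} → y ∉ X → column θ q y ≈ᴱ 𝟘
        entry≈0 {y} y∉X = ground⇒≈𝟘 _ λ v v∈ →
          case subst (x₀ ∈Var_) (m≡𝟘 y∉X) (x₀∈m (x₀∈ v∈)) of λ { (arg ()) }
          where
          x₀∈m : x₀ ∈Var column θ q y → x₀ ∈Var proj₁ (m y)
          x₀∈m x₀∈col = ∈Var-≈ E regular (≈-sym (m≈ y)) (arg (here (∈Var-⟨⟩ x₀∈col x₀∈τq)))
          x₀∈ : ∀ {v} → v ∈Var column θ q y → x₀ ∈Var column θ q y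
          x₀∈ v∈ = subst (_∈Var column θ q y) (sym (proj₂ (entry y) v∈)) v∈

        cutoff-column : ∀ {c} → (∀ y → y ∈ X → entry y ≈ˢ c y) → IsColumn θ q (cutoff c)
        cutoff-column entry≈c y with y ∈? X
        ... | yes y∈X = entry≈c y y∈X
        ... | no  y∉X = entry≈0 y∉X

        some-candidate : ¬ ¬ Anyˡ (λ c → IsColumn θ q (cutoff c)) candidates
        some-candidate k = ¬¬-∀∈ X (λ y _ → entry-≼ y) λ entry≼m →
          k (Any.map cutoff-column (choices⁺ _≟ⱽ_ X λ y y∈ → proj₂ (finiteBelow (m y)) (entry y) (entry≼m y y∈)))

      Has-extension : ∀ j → i ≤ j → Has gs j → ¬ ¬ Anyˡ (λ c → Has (cutoff c ∷ gs) j) candidates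
      Has-extension j i≤j (qs , qs! , shared , cols) k
        -- `m` is a column of `S i`, picked out by `e q₀`, hence also in the span of the later
        -- `S j`.
        with Span-OneVar (λ y → proj₂ (m y)) (Span-≤ i≤j (e q₀ , λ _ → ≈-refl))
      ... | τ , τ₁ , Sτ≈m with new-column cols τ τ₁
      ...   | inj₂ gen = ¬generated (Generated-≈ gs Sτ≈m gen)
      ...   | inj₁ (q , q-shared , q∉qs , x₀∈τq) = some-candidate (S j) τ τ₁ Sτ≈m x₀∈τq λ found →
                k (Any.map (λ col → q ∷ qs , ¬Any⇒All¬ qs q∉qs ∷ qs! , q-shared ∷ shared , col ∷ cols) found)

    all-generated⇒⊥ : ∀ gs → InfinitelyOften (Has gs) → ¬ (∀ i q → ¬ ¬ Generated gs (column (S i) q))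
    all-generated⇒⊥ gs inf gen = inf 0 λ (i , _ , qs , _ , _ , cols) →
      -- The concatenation is stable for both matrices, so only its finitely many columns have to be
      -- spanned; this gives `σ i` below `σ (suc i)`, against strictness.
      ¬¬-∀∈ (Z i ++ Z (suc i)) (λ q _ ¬span → gen (suc i) q (¬span ∘ Generated⇒Span (Span-σ₀ i) cols)) λ spans →
      proj₂ (descending i) (columns⇒≤ᴱ (σ i) (σ (suc i)) (Stable-⊇ (stable i) ∈-++⁺ˡ)
                                        (Stable-⊇ (stable (suc i)) (∈-++⁺ʳ (Z i))) spans)

    -- `n` counts the columns still to be added: each extension of `gs` lowers it by one and keeps
    -- the bound, and at zero `gs` is too long for `length-Has`.
    ¬InfinitelyOften-Has : ∀ n gs → length W < n + length gs → ¬ InfinitelyOften (Has gs)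
    ¬InfinitelyOften-Has zero    gs W< inf = inf 0 λ (i , _ , has) → <⇒≱ W< (length-Has {i = i} has)
    ¬InfinitelyOften-Has (suc n) gs W< inf = all-generated⇒⊥ gs inf λ i q ¬gen →
      InfinitelyOften-pigeonhole (candidates gs i q ¬gen) i (Has-extension gs i q ¬gen) inf λ c →
      ¬InfinitelyOften-Has n (_ ∷ gs) (≤-trans W< (≤-reflexive (sym (+-suc n _))))

    ¬descending : ⊥
    -- The empty list of columns is present at every index, and `suc (length W)` extensions exceed
    -- the bound.
    ¬descending = ¬InfinitelyOften-Has (suc (length W)) [] (≤-reflexive (sym (+-identityʳ _)))
                    λ N none → none (N , ≤-reflexive refl , [] , [] , [] , [])

proposition6p25 : ∀ {ℓ ℓ′ : Level} {V : Set} (E : EquationalTheory V ℓ) (M : Monoidal E) (x : V) →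
    Regular E → Restrictive ℓ′ E M x → Noetherian E
proposition6p25 E M x regular (_ , restricting) (σ , descending) =
  ¬descending E M x regular restricting σ descending
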